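{- Let $f:\omega\to\omega$ satisfy $\gamma(f)<1$ and let $X\subseteq\omega$ be $1$-generic relative to $f$. Then $\gamma^X(f)<1$.
   Context: For $C\subseteq\omega$, $\rho_n(C)=|C\cap\{0,\dots,n-1\}|/n$ and $\underline{\rho}(C)=\liminf_n\rho_n(C)$. $\gamma(f)=\sup\{r:$ some total computable $g$ has $\underline{\rho}(\{n:g(n)=f(n)\})\ge r\}$, and $\gamma^X(f)$ is the same with ``$X$-computable'' in place of ``computable''. $X$ is $1$-generic relative to $f$ if for every $f$-c.e. set $S$ of finite binary strings, either some initial segment of $X$ lies in $S$, or some initial segment of $X$ has no extension in $S$. -}

module Defs where

open import Data.Nat using (ℕ; zero; suc; _+_; _*_; _≤_; _<_; _≡ᵇ_)
open import Data.Fin using (Fin)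
open import Data.Vec using (Vec; []; _∷_; lookup)
open import Data.Bool using (Bool; true; false; if_then_else_)
open import Data.List using (List; []; _∷_; _++_)
open import Data.Product using (Σ; ∃; _×_; _,_)
open import Data.Sum using (_⊎_)
open import Data.Integer using (+_)
open import Data.Rational using (ℚ; 0ℚ; 1ℚ) renaming (_<_ to _<ℚ_; _≤_ to _≤ℚ_; _-_ to _-ℚ_; _/_ to _/ℚ_)
open import Relation.Nullary using (¬_)

Oracle : Set
Oracle = ℕ → ℕ

data Code : ℕ → Set where
  zer  : ∀ {k} → Code k
  succ : Code 1
  proj : ∀ {k} → Fin k → Code k
  orac : Code 1
  comp : ∀ {k m} → Code m → Vec (Code k) m → Code k
  prim : ∀ {k} → Code k → Code (suc (suc k)) → Code (suc k)
  mu   : ∀ {k} → Code (suc k) → Code k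

mutual
  data Eval (O : Oracle) : ∀ {k} → Code k → Vec ℕ k → ℕ → Set where
    ev-zer  : ∀ {k} {xs : Vec ℕ k} → Eval O zer xs 0
    ev-succ : ∀ {x} → Eval O succ (x ∷ []) (suc x)
    ev-proj : ∀ {k} {i : Fin k} {xs} → Eval O (proj i) xs (lookup xs i)
    ev-orac : ∀ {x} → Eval O orac (x ∷ []) (O x)
    ev-comp : ∀ {k m} {f : Code m} {gs : Vec (Code k) m} {xs ys v} →
              EvalAll O gs xs ys → Eval O f ys v → Eval O (comp f gs) xs v
    ev-prim0 : ∀ {k} {b : Code k} {s} {xs v} →
               Eval O b xs v → Eval O (prim b s) (0 ∷ xs) v
    ev-primS : ∀ {k} {b : Code k} {s} {n xs r v} →
               Eval O (prim b s) (n ∷ xs) r → Eval O s (n ∷ r ∷ xs) v →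
               Eval O (prim b s) (suc n ∷ xs) v
    ev-mu   : ∀ {k} {c : Code (suc k)} {xs y} →
              Eval O c (y ∷ xs) 0 →
              (∀ z → z < y → ∃ λ w → Eval O c (z ∷ xs) (suc w)) →
              Eval O (mu c) xs y

  data EvalAll (O : Oracle) {k : ℕ} : ∀ {m} → Vec (Code k) m → Vec ℕ k → Vec ℕ m → Set where
    []  : ∀ {xs} → EvalAll O [] xs []
    _∷_ : ∀ {m} {g : Code k} {gs : Vec (Code k) m} {xs y ys} →
          Eval O g xs y → EvalAll O gs xs ys → EvalAll O (g ∷ gs) xs (y ∷ ys)

Computable : Oracle → (ℕ → ℕ) → Set
Computable O g = Σ (Code 1) λ c → ∀ n → Eval O c (n ∷ []) (g n)

-- the empty oracle: computability relative to it is plain computability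
∅O : Oracle
∅O _ = 0

χ : (ℕ → Bool) → Oracle
χ X n = if X n then 1 else 0

agree : (ℕ → ℕ) → (ℕ → ℕ) → ℕ → ℕ
agree f g zero = 0
agree f g (suc n) = agree f g n + (if g n ≡ᵇ f n then 1 else 0)

-- ρ_{m+1}({i : g i = f i})
ρ : (ℕ → ℕ) → (ℕ → ℕ) → ℕ → ℚ
ρ f g m = (+ agree f g (suc m)) /ℚ (suc m)

LowerDensity≥ : (ℕ → ℕ) → (ℕ → ℕ) → ℚ → Set
LowerDensity≥ f g r =
  ∀ (ε : ℚ) → 0ℚ <ℚ ε → ∃ λ N → ∀ m → N ≤ m → (r -ℚ ε) ≤ℚ ρ f g m

-- γ^O(f) < 1 : there is a rational q < 1 such that no total
-- O-computable g has lower agreement density ≥ q.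
-- (sup_g liminf_n ρ_n < 1  iff  this holds.)
γ<1 : Oracle → (ℕ → ℕ) → Set
γ<1 O f = ∃ λ q → q <ℚ 1ℚ × (∀ g → Computable O g → ¬ LowerDensity≥ f g q)

-- standard bijective coding of binary strings by naturals
⌜_⌝ : List Bool → ℕ
⌜ [] ⌝ = 0
⌜ false ∷ s ⌝ = suc (2 * ⌜ s ⌝)
⌜ true ∷ s ⌝ = suc (suc (2 * ⌜ s ⌝))

_↾_ : (ℕ → Bool) → ℕ → List Bool
X ↾ zero = []
X ↾ suc n = (X ↾ n) ++ (X n ∷ [])

-- σ ∈ W_c^O  (the O-c.e. set of strings enumerated as domain of code c)
InW : Oracle → Code 1 → List Bool → Set
InW O c σ = ∃ λ v → Eval O (c) (⌜ σ ⌝ ∷ []) v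

OneGeneric : (ℕ → ℕ) → (ℕ → Bool) → Set
OneGeneric f X = ∀ (c : Code 1) →
  (∃ λ n → InW f c (X ↾ n)) ⊎ (∃ λ n → ∀ τ → ¬ InW f c ((X ↾ n) ++ τ))

{-# OPTIONS --safe #-}
module Submission where

-- Let g = Φ^X have lower agreement density close to 1 with f, so that from some
-- N on the fraction of disagreements in [0, n) is small.  The strings σ such that
-- Φ^σ converges on some [0, n), n ≥ N, with too many disagreements form an f-c.e.
-- set which X does not meet, so by genericity some initial segment σ of X has no
-- extension in it.  Extensions of σ on which Φ converges on [0, 2^(j+1)) exist
-- (along X) and can be found by search; using the j-th one only on the block
-- [2^j, 2^(j+1)) gives a computable function.  Its disagreements in [0, n) are at
-- most three times the permitted number, up to a constant, because those of the
-- earlier blocks sum geometrically.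

open import Defs
open import Data.Nat using (ℕ; zero; suc; pred; _+_; _*_; _∸_; _≤_; _<_; _⊔_; _≡ᵇ_; z≤n; s≤s)
open import Data.Nat.Properties
open import Data.Nat.Solver using (module +-*-Solver)
open import Data.Fin using (Fin; zero; suc)
open import Data.Vec using (Vec; []; _∷_; lookup; head; tail; tabulate)
open import Data.Vec.Properties using (tabulate∘lookup)
open import Data.Bool using (Bool; true; false; if_then_else_)
open import Data.List using (List; []; _∷_; _++_)
open import Data.List.Properties using (++-assoc; ++-identityʳ)
open import Data.Product using (Σ; ∃; _×_; _,_; proj₁; proj₂)
open import Data.Sum using (_⊎_; inj₁; inj₂)
import Data.Integer as ℤ
import Data.Integer.Properties as ℤ
import Data.Rational as ℚ
import Data.Rational.Properties as ℚ
import Data.Rational.Unnormalised as ℚᵘ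
import Data.Rational.Unnormalised.Properties as ℚᵘ
open import Function using (_∘_)
open import Relation.Nullary using (¬_; contradiction)
open import Relation.Binary.Definitions using (tri<; tri≈; tri>)
open import Relation.Binary.PropositionalEquality using (_≡_; refl; sym; trans; cong; cong₂; subst; subst₂)

open +-*-Solver using (solve; con; _:+_; _:*_; _:=_)

-- Determinism of evaluation

mutual
  -- Of two different results of one minimisation, the smaller would make the body evaluate both to
  -- `0` and to a successor. Determinism lets membership in a domain be read back as an equation in
  -- `∈defectSet⇒`.
  Eval-functional : ∀ {O k} {c : Code k} {xs v w} → Eval O c xs v → Eval O c xs w → v ≡ w
  Eval-functional ev-zer ev-zer = refl
  Eval-functional ev-succ ev-succ = refl
  Eval-functional ev-proj ev-proj = refl
  Eval-functional ev-orac ev-orac = refl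
  Eval-functional (ev-comp as e) (ev-comp as′ e′) with refl ← EvalAll-functional as as′ =
    Eval-functional e e′
  Eval-functional (ev-prim0 e) (ev-prim0 e′) = Eval-functional e e′
  Eval-functional (ev-primS r e) (ev-primS r′ e′) with refl ← Eval-functional r r′ =
    Eval-functional e e′
  Eval-functional (ev-mu {y = y} e before) (ev-mu {y = y′} e′ before′)
    with <-cmp y y′
  ... | tri< y<y′ _ _ with () ← Eval-functional e (proj₂ (before′ y y<y′))
  ... | tri≈ _ y≡y′ _ = y≡y′
  ... | tri> _ _ y′<y with () ← Eval-functional (proj₂ (before y′ y′<y)) e′

  EvalAll-functional : ∀ {O k m} {gs : Vec (Code k) m} {xs ys zs} →
                       EvalAll O gs xs ys → EvalAll O gs xs zs → ys ≡ zs
  EvalAll-functional [] [] = refl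
  EvalAll-functional (e ∷ as) (e′ ∷ as′) =
    cong₂ _∷_ (Eval-functional e e′) (EvalAll-functional as as′)

pattern v₀ = zero
pattern v₁ = suc zero
pattern v₂ = suc (suc zero)

-- Total recursive functions

Fun : ℕ → Set
Fun k = Vec ℕ k → ℕ

Rec : Oracle → ∀ {k} → Fun k → Set
Rec O {k} F = Σ (Code k) λ c → ∀ xs → Eval O c xs (F xs)

-- The conclusion has the shape of the premises of `ev-mu`. The recursion is on the known zero while
-- `h` is shifted.
least-zero : (h : ℕ → ℕ) → (∃ λ y → h y ≡ 0) →
             ∃ λ y → h y ≡ 0 × (∀ z → z < y → ∃ λ w → h z ≡ suc w)
least-zero h (y , hy≡0) = go h y hy≡0
  where
  go : (h : ℕ → ℕ) (y : ℕ) → h y ≡ 0 →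
       ∃ λ y → h y ≡ 0 × (∀ z → z < y → ∃ λ w → h z ≡ suc w)
  go h y hy≡0 with h 0 in h0
  go h y       hy≡0 | zero  = 0 , h0 , λ _ ()
  go h zero    hy≡0 | suc w with () ← trans (sym hy≡0) h0
  go h (suc y) hy≡0 | suc w with go (h ∘ suc) y hy≡0
  ... | m , hm≡0 , before = suc m , hm≡0 , λ where
    zero    _         → w , h0
    (suc z) (s≤s z<m) → before z z<m

module _ {O : Oracle} where

  rec-ext : ∀ {k} {F G : Fun k} → (∀ xs → F xs ≡ G xs) → Rec O F → Rec O G
  rec-ext F≗G (c , ev) = c , λ xs → subst (Eval O c xs) (F≗G xs) (ev xs)

  rec-var : ∀ {k} (i : Fin k) → Rec O (λ xs → lookup xs i)
  rec-var i = proj i , λ _ → ev-proj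

  rec-subst : ∀ {k m} {F : Fun m} (G : Fin m → Fun k) → Rec O F → (∀ i → Rec O (G i)) →
              Rec O (λ xs → F (tabulate (λ i → G i xs)))
  rec-subst {k} G (c , ev) gs =
    comp c (tabulate (proj₁ ∘ gs)) , λ xs → ev-comp (all G gs xs) (ev _)
    where
    all : ∀ {m} (G : Fin m → Fun k) (gs : ∀ i → Rec O (G i)) xs →
          EvalAll O (tabulate (proj₁ ∘ gs)) xs (tabulate (λ i → G i xs))
    all {zero}  G gs xs = []
    all {suc m} G gs xs = proj₂ (gs zero) xs ∷ all (G ∘ suc) (gs ∘ suc) xs

  Rec₁ : (ℕ → ℕ) → Set
  Rec₁ F = Σ (Code 1) λ c → ∀ x → Eval O c (x ∷ []) (F x)

  Rec₂ : (ℕ → ℕ → ℕ) → Set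
  Rec₂ F = Σ (Code 2) λ c → ∀ x y → Eval O c (x ∷ y ∷ []) (F x y)

  Rec₃ : (ℕ → ℕ → ℕ → ℕ) → Set
  Rec₃ F = Σ (Code 3) λ c → ∀ x y z → Eval O c (x ∷ y ∷ z ∷ []) (F x y z)

  curry₁ : ∀ {F} → Rec O (λ v → F (lookup v v₀)) → Rec₁ F
  curry₁ (c , ev) = c , λ x → ev (x ∷ [])

  curry₂ : ∀ {F} → Rec O (λ v → F (lookup v v₀) (lookup v v₁)) → Rec₂ F
  curry₂ (c , ev) = c , λ x y → ev (x ∷ y ∷ [])

  curry₃ : ∀ {F} → Rec O (λ v → F (lookup v v₀) (lookup v v₁) (lookup v v₂)) → Rec₃ F
  curry₃ (c , ev) = c , λ x y z → ev (x ∷ y ∷ z ∷ [])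

  ap₁ : ∀ {F k} {G : Fun k} → Rec₁ F → Rec O G → Rec O (λ xs → F (G xs))
  ap₁ (c , ev) (g , evg) = comp c (g ∷ []) , λ xs → ev-comp (evg xs ∷ []) (ev _)

  ap₂ : ∀ {F k} {G H : Fun k} → Rec₂ F → Rec O G → Rec O H → Rec O (λ xs → F (G xs) (H xs))
  ap₂ (c , ev) (g , evg) (h , evh) =
    comp c (g ∷ h ∷ []) , λ xs → ev-comp (evg xs ∷ evh xs ∷ []) (ev _ _)

  ap₃ : ∀ {F k} {G H I : Fun k} → Rec₃ F → Rec O G → Rec O H → Rec O I →
        Rec O (λ xs → F (G xs) (H xs) (I xs))
  ap₃ (c , ev) (g , evg) (h , evh) (i , evi) =
    comp c (g ∷ h ∷ i ∷ []) , λ xs → ev-comp (evg xs ∷ evh xs ∷ evi xs ∷ []) (ev _ _ _)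

  -- `F` is defined beforehand; the two equations certify that it obeys the recursion and often hold
  -- by `refl`.
  rec-prim : ∀ {k} {F : Fun (suc k)} {B : Fun k} {S : Fun (suc (suc k))} →
             (∀ xs → B xs ≡ F (0 ∷ xs)) →
             (∀ n xs → S (n ∷ F (n ∷ xs) ∷ xs) ≡ F (suc n ∷ xs)) →
             Rec O B → Rec O S → Rec O F
  rec-prim {F = F} F-zero F-suc (b , evb) (s , evs) = prim b s , λ { (n ∷ xs) → go n xs }
    where
    go : ∀ n xs → Eval O (prim b s) (n ∷ xs) (F (n ∷ xs))
    go zero    xs = ev-prim0 (subst (Eval O b xs) (F-zero xs) (evb xs))
    go (suc n) xs = ev-primS (go n xs) (subst (Eval O s _) (F-suc n xs) (evs _))

  -- `total` makes the minimum a function, but the code `mu c` does not depend on it.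
  rec-mu : ∀ {k} {F : Fun (suc k)} → Rec O F → (total : ∀ xs → ∃ λ y → F (y ∷ xs) ≡ 0) →
           Rec O (λ xs → proj₁ (least-zero (λ y → F (y ∷ xs)) (total xs)))
  rec-mu {F = F} (c , ev) total = mu c , λ xs →
    let y , Fy≡0 , before = least-zero (λ y → F (y ∷ xs)) (total xs) in
    ev-mu (subst (Eval O c _) Fy≡0 (ev _))
          (λ z z<y → let w , Fz≡w = before z z<y in w , subst (Eval O c _) Fz≡w (ev _))

  rec-suc : Rec₁ suc
  rec-suc = succ , λ _ → ev-succ

  rec-const : ∀ n {k} → Rec O {k} (λ _ → n)
  rec-const zero    = zer , λ _ → ev-zer
  rec-const (suc n) = ap₁ rec-suc (rec-const n)

  rec-pred : Rec₁ pred
  rec-pred = curry₁ (rec-prim (λ { [] → refl }) (λ { _ [] → refl }) (rec-const 0) (rec-var v₀))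

  rec-+ : Rec₂ _+_
  rec-+ = curry₂ (rec-prim (λ { (_ ∷ []) → refl }) (λ { _ (_ ∷ []) → refl })
                   (rec-var v₀) (ap₁ rec-suc (rec-var v₁)))

  rec-∸ : Rec₂ _∸_
  rec-∸ = curry₂ (ap₂ flipped (rec-var v₁) (rec-var v₀))
    where
    flipped : Rec₂ (λ n m → m ∸ n)
    flipped = curry₂ (rec-prim (λ { (_ ∷ []) → refl }) (λ { n (m ∷ []) → pred[m∸n]≡m∸[1+n] m n })
                       (rec-var v₀) (ap₁ rec-pred (rec-var v₁)))

  rec-scale : ∀ K {k} {G : Fun k} → Rec O G → Rec O (λ xs → K * G xs)
  rec-scale zero    g = rec-const 0
  rec-scale (suc K) g = ap₂ rec-+ g (rec-scale K g)

-- Coded binary strings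

parity : ℕ → ℕ
parity zero    = 0
parity (suc n) = 1 ∸ parity n

half : ℕ → ℕ
half zero    = 0
half (suc n) = parity n + half n

parity-2* : ∀ s → parity (2 * s) ≡ 0
parity-2* zero = refl
parity-2* (suc s) rewrite +-suc s (s + 0) | parity-2* s = refl

half-2* : ∀ s → half (2 * s) ≡ s
half-2* zero = refl
half-2* (suc s) rewrite +-suc s (s + 0) | parity-2* s = cong suc (half-2* s)

half-1+2* : ∀ s → half (suc (2 * s)) ≡ s
half-1+2* s rewrite parity-2* s = half-2* s

-- A nonempty string has code `suc n` with `n = 2 s + b`, where `s` codes the tail and `b` is the
-- first bit; `half` and `parity` recover the two parts.
tailCode : ℕ → ℕ
tailCode zero    = 0
tailCode (suc n) = half n

headCode : ℕ → ℕ
headCode zero    = 0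
headCode (suc n) = suc (parity n)

dropCode : ℕ → ℕ → ℕ
dropCode zero    a = a
dropCode (suc n) a = tailCode (dropCode n a)

-- 0 off the string, otherwise the bit increased by one.
bitCode : ℕ → ℕ → ℕ
bitCode a n = headCode (dropCode n a)

bit : Bool → ℕ
bit b = if b then 1 else 0

tailCode-∷ : ∀ b σ → tailCode ⌜ b ∷ σ ⌝ ≡ ⌜ σ ⌝
tailCode-∷ false σ = half-2* ⌜ σ ⌝
tailCode-∷ true  σ = half-1+2* ⌜ σ ⌝

headCode-∷ : ∀ b σ → headCode ⌜ b ∷ σ ⌝ ≡ suc (bit b)
headCode-∷ false σ = cong suc (parity-2* ⌜ σ ⌝)
headCode-∷ true  σ = cong (λ p → suc (1 ∸ p)) (parity-2* ⌜ σ ⌝)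

dropCode-tailCode : ∀ n a → dropCode n (tailCode a) ≡ tailCode (dropCode n a)
dropCode-tailCode zero    a = refl
dropCode-tailCode (suc n) a = cong tailCode (dropCode-tailCode n a)

bitCode-[] : ∀ n → bitCode ⌜ [] ⌝ n ≡ 0
bitCode-[] n = cong headCode (dropCode-0 n)
  where
  dropCode-0 : ∀ n → dropCode n 0 ≡ 0
  dropCode-0 zero    = refl
  dropCode-0 (suc n) = cong tailCode (dropCode-0 n)

bitCode-∷-suc : ∀ b σ n → bitCode ⌜ b ∷ σ ⌝ (suc n) ≡ bitCode ⌜ σ ⌝ n
bitCode-∷-suc b σ n = cong headCode
  (trans (sym (dropCode-tailCode n ⌜ b ∷ σ ⌝)) (cong (dropCode n) (tailCode-∷ b σ)))

-- Initial segments grow at the right end, while codes are read from the left; this lets an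
-- induction on length peel off the first bit.
↾-suc : ∀ X n → X ↾ suc n ≡ X 0 ∷ ((X ∘ suc) ↾ n)
↾-suc X zero    = refl
↾-suc X (suc n) = cong (_++ (X (suc n) ∷ [])) (↾-suc X n)

bitCode-↾ : ∀ X n x → bitCode ⌜ X ↾ n ⌝ x ≡ 0 ⊎ bitCode ⌜ X ↾ n ⌝ x ≡ suc (χ X x)
bitCode-↾ X zero    x = inj₁ (bitCode-[] x)
bitCode-↾ X (suc n) zero rewrite ↾-suc X n = inj₂ (headCode-∷ (X 0) ((X ∘ suc) ↾ n))
bitCode-↾ X (suc n) (suc x) rewrite ↾-suc X n | bitCode-∷-suc (X 0) ((X ∘ suc) ↾ n) x =
  bitCode-↾ (X ∘ suc) n x

bitCode-↾-< : ∀ X n x → x < n → bitCode ⌜ X ↾ n ⌝ x ≡ suc (χ X x)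
bitCode-↾-< X (suc n) zero _ rewrite ↾-suc X n = headCode-∷ (X 0) ((X ∘ suc) ↾ n)
bitCode-↾-< X (suc n) (suc x) (s≤s x<n)
  rewrite ↾-suc X n | bitCode-∷-suc (X 0) ((X ∘ suc) ↾ n) x = bitCode-↾-< (X ∘ suc) n x x<n

-- The code of the oracle string doubles as the bound on minimisations, so it has to become
-- arbitrarily large along `X`.
n≤⌜↾n⌝ : ∀ X n → n ≤ ⌜ X ↾ n ⌝
n≤⌜↾n⌝ X zero = z≤n
n≤⌜↾n⌝ X (suc n) rewrite ↾-suc X n = ≤-trans (s≤s (n≤⌜↾n⌝ (X ∘ suc) n)) (step (X 0) ((X ∘ suc) ↾ n))
  where
  step : ∀ b σ → suc ⌜ σ ⌝ ≤ ⌜ b ∷ σ ⌝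
  step false σ = s≤s (m≤m+n _ _)
  step true  σ = s≤s (≤-trans (m≤m+n _ _) (n≤1+n _))

↾-+ : ∀ X n m → ∃ λ τ → X ↾ (m + n) ≡ (X ↾ n) ++ τ
↾-+ X n zero    = [] , sym (++-identityʳ _)
↾-+ X n (suc m) with ↾-+ X n m
... | τ , eq = τ ++ (X (m + n) ∷ []) ,
  trans (cong (_++ (X (m + n) ∷ [])) eq) (++-assoc (X ↾ n) τ _)

-- A search over numbers thereby ranges over strings. `next` is the successor in bijective base two,
-- least significant digit first.
⌜⌝-surjective : ∀ t → ∃ λ σ → ⌜ σ ⌝ ≡ t
⌜⌝-surjective zero    = [] , refl
⌜⌝-surjective (suc t) with ⌜⌝-surjective t
... | σ , eq = next σ , trans (next-suc σ) (cong suc eq)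
  where
  next : List Bool → List Bool
  next []          = false ∷ []
  next (false ∷ σ) = true ∷ σ
  next (true ∷ σ)  = false ∷ next σ

  next-suc : ∀ σ → ⌜ next σ ⌝ ≡ suc ⌜ σ ⌝
  next-suc []          = refl
  next-suc (false ∷ σ) = refl
  next-suc (true ∷ σ) rewrite next-suc σ | +-suc ⌜ σ ⌝ (⌜ σ ⌝ + 0) = refl

-- Concatenation acting on codes: only the fixed string `σ` is unfolded, so the second string is
-- never decoded.
prepend : List Bool → ℕ → ℕ
prepend []          t = t
prepend (false ∷ σ) t = suc (2 * prepend σ t)
prepend (true ∷ σ)  t = suc (suc (2 * prepend σ t))

prepend-⌜⌝ : ∀ σ τ → prepend σ ⌜ τ ⌝ ≡ ⌜ σ ++ τ ⌝
prepend-⌜⌝ []          τ = refl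
prepend-⌜⌝ (false ∷ σ) τ = cong (λ t → suc (2 * t)) (prepend-⌜⌝ σ τ)
prepend-⌜⌝ (true ∷ σ)  τ = cong (λ t → suc (suc (2 * t))) (prepend-⌜⌝ σ τ)

-- Partial values are coded in ℕ: 0 means undefined, suc v means defined with value v.

guard : ℕ → ℕ → ℕ
guard zero    _ = 0
guard (suc _) v = v

iterate : ℕ → (ℕ → ℕ → ℕ) → ℕ → ℕ
iterate b s zero    = b
iterate b s (suc n) = guard (iterate b s n) (s n (pred (iterate b s n)))

whenZero : ℕ → ℕ → ℕ
whenZero zero    n = suc (suc n)
whenZero (suc _) n = 0

verdict : ℕ → ℕ → ℕ
verdict zero    n = 1
verdict (suc v) n = whenZero v n

step : ℕ → ℕ → ℕ → ℕ
step zero    n v = verdict v n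
step (suc r) n v = suc r

-- State of a minimisation after n tests: 0 while searching, 1 once an
-- undefined value has been met, 2 + y once the least zero y has been found.
search : (ℕ → ℕ) → ℕ → ℕ
search h zero    = 0
search h (suc n) = step (search h n) n (h n)

-- The value of a code computed with the string coded by a as its oracle; a
-- also bounds every minimisation, which makes the function primitive recursive.
mutual
  approx : ∀ {k} → Code k → ℕ → Vec ℕ k → ℕ
  approx zer         a xs = 1
  approx succ        a xs = suc (suc (lookup xs v₀))
  approx (proj i)    a xs = suc (lookup xs i)
  approx orac        a xs = bitCode a (lookup xs v₀)
  approx (comp c cs) a xs = guard (defined cs a xs) (approx c a (values cs a xs))
  approx (prim b s)  a xs =
    iterate (approx b a (tail xs)) (λ n r → approx s a (n ∷ r ∷ tail xs)) (head xs)
  -- The states `0` and `1` both become undefined, and `2 + y` becomes the defined value `y`.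
  approx (mu c)      a xs = pred (search (λ y → approx c a (y ∷ xs)) a)

  defined : ∀ {k m} → Vec (Code k) m → ℕ → Vec ℕ k → ℕ
  defined []       a xs = 1
  defined (c ∷ cs) a xs = guard (approx c a xs) (defined cs a xs)

  values : ∀ {k m} → Vec (Code k) m → ℕ → Vec ℕ k → Vec ℕ m
  values []       a xs = []
  values (c ∷ cs) a xs = pred (approx c a xs) ∷ values cs a xs

-- Recursiveness of the approximation

module _ {O : Oracle} where

  rec-1∸ : Rec₁ {O} (λ n → 1 ∸ n)
  rec-1∸ = curry₁ (ap₂ rec-∸ (rec-const 1) (rec-var v₀))

  rec-parity : Rec₁ {O} parity
  rec-parity = curry₁ (rec-prim (λ { [] → refl }) (λ { _ [] → refl })
                        (rec-const 0) (ap₁ rec-1∸ (rec-var v₁)))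

  rec-half : Rec₁ {O} half
  rec-half = curry₁ (rec-prim (λ { [] → refl }) (λ { _ [] → refl })
                      (rec-const 0) (ap₂ rec-+ (ap₁ rec-parity (rec-var v₀)) (rec-var v₁)))

  rec-tailCode : Rec₁ {O} tailCode
  rec-tailCode = curry₁ (rec-prim (λ { [] → refl }) (λ { _ [] → refl })
                          (rec-const 0) (ap₁ rec-half (rec-var v₀)))

  rec-headCode : Rec₁ {O} headCode
  rec-headCode = curry₁ (rec-prim (λ { [] → refl }) (λ { _ [] → refl })
                          (rec-const 0) (ap₁ rec-suc (ap₁ rec-parity (rec-var v₀))))

  rec-dropCode : Rec₂ {O} dropCode
  rec-dropCode = curry₂ (rec-prim (λ { (_ ∷ []) → refl }) (λ { _ (_ ∷ []) → refl })
                          (rec-var v₀) (ap₁ rec-tailCode (rec-var v₁)))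

  rec-bitCode : Rec₂ {O} bitCode
  rec-bitCode = curry₂ (ap₁ rec-headCode (ap₂ rec-dropCode (rec-var v₁) (rec-var v₀)))

  rec-prepend : ∀ σ → Rec₁ {O} (prepend σ)
  rec-prepend []          = curry₁ (rec-var v₀)
  rec-prepend (false ∷ σ) =
    curry₁ (ap₁ rec-suc (rec-scale 2 (ap₁ (rec-prepend σ) (rec-var v₀))))
  rec-prepend (true ∷ σ)  =
    curry₁ (ap₁ rec-suc (ap₁ rec-suc (rec-scale 2 (ap₁ (rec-prepend σ) (rec-var v₀)))))

  rec-guard : Rec₂ {O} guard
  rec-guard = curry₂ (rec-prim (λ { (_ ∷ []) → refl }) (λ { _ (_ ∷ []) → refl })
                       (rec-const 0) (rec-var v₂))

  rec-whenZero : Rec₂ {O} whenZero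
  rec-whenZero = curry₂ (rec-prim (λ { (_ ∷ []) → refl }) (λ { _ (_ ∷ []) → refl })
                          (ap₁ rec-suc (ap₁ rec-suc (rec-var v₀))) (rec-const 0))

  rec-verdict : Rec₂ {O} verdict
  rec-verdict = curry₂ (rec-prim (λ { (_ ∷ []) → refl }) (λ { _ (_ ∷ []) → refl })
                         (rec-const 1) (ap₂ rec-whenZero (rec-var v₀) (rec-var v₂)))

  rec-step : Rec₃ {O} step
  rec-step = curry₃ (rec-prim (λ { (_ ∷ _ ∷ []) → refl }) (λ { _ (_ ∷ _ ∷ []) → refl })
                      (ap₂ rec-verdict (rec-var v₁) (rec-var v₀)) (ap₁ rec-suc (rec-var v₀)))

  RecString : ∀ {k} → (ℕ → Vec ℕ k → ℕ) → Set
  RecString F = Rec O (λ v → F (head v) (tail v))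

  mutual
    rec-approx : ∀ {k} (c : Code k) → RecString (approx c)
    rec-approx zer      = rec-const 1
    rec-approx succ     = rec-ext (λ { (_ ∷ _ ∷ []) → refl })
                            (ap₁ rec-suc (ap₁ rec-suc (rec-var v₁)))
    rec-approx (proj i) = rec-ext (λ { (_ ∷ _) → refl }) (ap₁ rec-suc (rec-var (suc i)))
    rec-approx orac     = rec-ext (λ { (_ ∷ _ ∷ []) → refl })
                            (ap₂ rec-bitCode (rec-var v₀) (rec-var v₁))
    rec-approx (comp c cs) =
      ap₂ rec-guard (rec-defined cs)
        (rec-ext (λ { (a ∷ xs) → cong (approx c a) (tabulate∘lookup (values cs a xs)) })
          (rec-subst G (rec-approx c) rec-G))
      where
      G : ∀ i → Fun _
      G zero    v = lookup v v₀
      G (suc i) v = lookup (values cs (head v) (tail v)) i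
      rec-G : ∀ i → Rec O (G i)
      rec-G zero    = rec-var v₀
      rec-G (suc i) = rec-values cs i
    -- The string code stands first, where `rec-prim` expects the recursion argument: `F` exchanges
    -- the two and `swap` restores the order.
    rec-approx (prim {k} b s) =
      rec-ext {F = λ v → F (tabulate (λ i → lookup v (swap i)))}
        (λ { (a ∷ n ∷ xs) → cong (λ ys → F (n ∷ a ∷ ys)) (tabulate∘lookup xs) })
        (rec-subst _ rec-F (λ i → rec-var (swap i)))
      where
      F : Fun (suc (suc k))
      F v = approx (prim b s) (lookup v v₁) (head v ∷ tail (tail v))
      swap : Fin (suc (suc k)) → Fin (suc (suc k))
      swap v₀            = v₁
      swap v₁            = v₀
      swap (suc (suc i)) = suc (suc i)
      G : Fin (suc (suc (suc k))) → Fun (suc (suc (suc k)))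
      G v₀                  v = lookup v v₂
      G v₁                  v = lookup v v₀
      G v₂                  v = pred (lookup v v₁)
      G (suc (suc (suc i))) v = lookup v (suc (suc (suc i)))
      rec-G : ∀ i → Rec O (G i)
      rec-G v₀                  = rec-var v₂
      rec-G v₁                  = rec-var v₀
      rec-G v₂                  = ap₁ rec-pred (rec-var v₁)
      rec-G (suc (suc (suc i))) = rec-var (suc (suc (suc i)))
      rec-F : Rec O F
      rec-F = rec-prim (λ { (a ∷ xs) → refl })
        (λ { n (a ∷ xs) → cong (λ ys → guard (F (n ∷ a ∷ xs))
                            (approx s a (n ∷ pred (F (n ∷ a ∷ xs)) ∷ ys))) (tabulate∘lookup xs) })
        (rec-approx b) (ap₂ rec-guard (rec-var v₁) (rec-subst G (rec-approx s) rec-G))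
    -- The number of tests is separated from the string code so that it can be the recursion
    -- argument; `diag` then identifies the two.
    rec-approx (mu {k} c) =
      rec-ext {F = λ v → pred (F (tabulate (λ i → lookup v (diag i))))}
        (λ { (a ∷ xs) → cong (λ ys → pred (F (a ∷ a ∷ ys))) (tabulate∘lookup xs) })
        (ap₁ rec-pred (rec-subst _ rec-F (λ i → rec-var (diag i))))
      where
      F : Fun (suc (suc k))
      F v = search (λ y → approx c (lookup v v₁) (y ∷ tail (tail v))) (head v)
      diag : Fin (suc (suc k)) → Fin (suc k)
      diag zero    = zero
      diag (suc i) = i
      G : Fin (suc (suc k)) → Fin (suc (suc (suc k)))
      G v₀            = v₂
      G v₁            = v₀
      G (suc (suc i)) = suc (suc (suc i))
      rec-F : Rec O F
      rec-F = rec-prim (λ { (a ∷ xs) → refl })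
        (λ { n (a ∷ xs) → cong (λ ys → step (F (n ∷ a ∷ xs)) n (approx c a (n ∷ ys)))
                            (tabulate∘lookup xs) })
        (rec-const 0)
        (ap₃ rec-step (rec-var v₁) (rec-var v₀)
          (rec-subst _ (rec-approx c) (λ i → rec-var (G i))))

    rec-defined : ∀ {k m} (cs : Vec (Code k) m) → RecString (defined cs)
    rec-defined []       = rec-const 1
    rec-defined (c ∷ cs) = ap₂ rec-guard (rec-approx c) (rec-defined cs)

    rec-values : ∀ {k m} (cs : Vec (Code k) m) i → RecString (λ a xs → lookup (values cs a xs) i)
    rec-values (c ∷ cs) zero    = ap₁ rec-pred (rec-approx c)
    rec-values (c ∷ cs) (suc i) = rec-values cs i

-- Approximations along `X` compared with true evaluation

Eventually : (ℕ → Set) → Set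
Eventually P = ∃ λ N → ∀ n → N ≤ n → P n

eventually-× : ∀ {P Q : ℕ → Set} → Eventually P → Eventually Q → Eventually (λ n → P n × Q n)
eventually-× (N , p) (M , q) = N ⊔ M , λ n le →
  p n (≤-trans (m≤m⊔n N M) le) , q n (≤-trans (m≤n⊔m N M) le)

eventually-map : ∀ {P Q : ℕ → Set} → (∀ n → P n → Q n) → Eventually P → Eventually Q
eventually-map f (N , p) = N , λ n le → f n (p n le)

eventually-all< : ∀ {P : ℕ → ℕ → Set} y → (∀ z → z < y → Eventually (P z)) →
                  Eventually (λ n → ∀ z → z < y → P z n)
eventually-all< zero    ev = 0 , λ _ _ _ ()
eventually-all< {P} (suc y) ev = eventually-map extend
  (eventually-× (eventually-all< y (λ z z<y → ev z (m<n⇒m<1+n z<y))) (ev y ≤-refl))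
  where
  extend : ∀ n → (∀ z → z < y → P z n) × P y n → ∀ z → z < suc y → P z n
  extend n (below , at) z z<1+y with m<1+n⇒m<n∨m≡n z<1+y
  ... | inj₁ z<y  = below z z<y
  ... | inj₂ refl = at

module _ {h : ℕ → ℕ} {y : ℕ} where

  -- In coded form `1` is the value zero and `suc (suc w)` a positive value. Before test `y` the
  -- search continues or gives up, test `y` ends it, and a nonzero state never changes.
  search-sound : h y ≡ 0 ⊎ h y ≡ 1 → (∀ z → z < y → h z ≡ 0 ⊎ ∃ λ w → h z ≡ suc (suc w)) →
                 ∀ n → pred (search h n) ≡ 0 ⊎ pred (search h n) ≡ suc y
  search-sound at before n with go at n
    where
    go : h y ≡ 0 ⊎ h y ≡ 1 →
         ∀ n → (n ≤ y × search h n ≡ 0) ⊎ (search h n ≡ 1 ⊎ search h n ≡ suc (suc y))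
    go at zero = inj₁ (z≤n , refl)
    go at (suc n) with go at n
    ... | inj₂ (inj₁ eq) rewrite eq = inj₂ (inj₁ refl)
    ... | inj₂ (inj₂ eq) rewrite eq = inj₂ (inj₂ refl)
    ... | inj₁ (n≤y , eq) rewrite eq with m≤n⇒m<n∨m≡n n≤y
    ...   | inj₁ n<y with before n n<y
    ...     | inj₁ hn       rewrite hn = inj₂ (inj₁ refl)
    ...     | inj₂ (w , hn) rewrite hn = inj₁ (n<y , refl)
    go at (suc n) | inj₁ (n≤y , eq) | inj₂ refl with at
    ...     | inj₁ hn rewrite hn = inj₂ (inj₁ refl)
    ...     | inj₂ hn rewrite hn = inj₂ (inj₂ refl)
  ... | inj₁ (_ , eq)  = inj₁ (cong pred eq)
  ... | inj₂ (inj₁ eq) = inj₁ (cong pred eq)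
  ... | inj₂ (inj₂ eq) = inj₂ (cong pred eq)

  search-complete : h y ≡ 1 → (∀ z → z < y → ∃ λ w → h z ≡ suc (suc w)) →
                    ∀ n → y < n → pred (search h n) ≡ suc y
  search-complete at before n y<n = cong pred (found n y<n)
    where
    searching : ∀ n → n ≤ y → search h n ≡ 0
    searching zero    _   = refl
    searching (suc n) n<y rewrite searching n (<⇒≤ n<y) | proj₂ (before n n<y) = refl
    found : ∀ n → y < n → search h n ≡ suc (suc y)
    found (suc n) y<1+n with m<1+n⇒m<n∨m≡n y<1+n
    ... | inj₁ y<n rewrite found n y<n = refl
    ... | inj₂ refl rewrite searching n ≤-refl | at = refl

module _ (X : ℕ → Bool) where

  mutual
    -- Unanswered queries and unfinished searches propagate as undefined, so a finite part of `X`
    -- may leave a value undefined but cannot falsify it.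
    approx-sound : ∀ {k} {c : Code k} {xs v} → Eval (χ X) c xs v →
                   ∀ n → approx c ⌜ X ↾ n ⌝ xs ≡ 0 ⊎ approx c ⌜ X ↾ n ⌝ xs ≡ suc v
    approx-sound ev-zer  n = inj₂ refl
    approx-sound ev-succ n = inj₂ refl
    approx-sound ev-proj n = inj₂ refl
    approx-sound (ev-orac {x}) n = bitCode-↾ X n x
    approx-sound (ev-comp as e) n with approx-sound-all as n
    ... | inj₁ eq rewrite eq = inj₁ refl
    ... | inj₂ (eq , eqs) rewrite eq | eqs = approx-sound e n
    approx-sound (ev-prim0 e) n = approx-sound e n
    approx-sound (ev-primS r e) n with approx-sound r n
    ... | inj₁ eq rewrite eq = inj₁ refl
    ... | inj₂ eq rewrite eq = approx-sound e n
    approx-sound (ev-mu e before) n = search-sound (approx-sound e n)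
      (λ z z<y → earlier z (proj₂ (before z z<y))) ⌜ X ↾ n ⌝
      where
      earlier : ∀ z {w} → Eval _ _ (z ∷ _) (suc w) → _
      earlier z e with approx-sound e n
      ... | inj₁ eq = inj₁ eq
      ... | inj₂ eq = inj₂ (_ , eq)

    approx-sound-all : ∀ {k m} {cs : Vec (Code k) m} {xs ys} → EvalAll (χ X) cs xs ys → ∀ n →
                       defined cs ⌜ X ↾ n ⌝ xs ≡ 0 ⊎
                       (defined cs ⌜ X ↾ n ⌝ xs ≡ 1 × values cs ⌜ X ↾ n ⌝ xs ≡ ys)
    approx-sound-all [] n = inj₂ (refl , refl)
    approx-sound-all (e ∷ es) n with approx-sound e n | approx-sound-all es n
    ... | inj₁ eq | _ rewrite eq = inj₁ refl
    ... | inj₂ eq | inj₁ eq′ rewrite eq = inj₁ eq′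
    ... | inj₂ eq | inj₂ (eq′ , eqs) rewrite eq = inj₂ (eq′ , cong (_ ∷_) eqs)

  mutual
    -- A halting computation uses finitely much of `X`; each rule takes the maximum of the
    -- thresholds of its premises.
    approx-complete : ∀ {k} {c : Code k} {xs v} → Eval (χ X) c xs v →
                      Eventually (λ n → approx c ⌜ X ↾ n ⌝ xs ≡ suc v)
    approx-complete ev-zer  = 0 , λ _ _ → refl
    approx-complete ev-succ = 0 , λ _ _ → refl
    approx-complete ev-proj = 0 , λ _ _ → refl
    approx-complete (ev-orac {x}) = suc x , λ n → bitCode-↾-< X n x
    approx-complete (ev-comp {f = c} {gs = cs} {xs = xs} {ys = ys} {v = v} as e) = eventually-map
      (λ n ((eq , eqs) , eq′) → both n eq eqs eq′)
      (eventually-× (approx-complete-all as) (approx-complete e))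
      where
      both : ∀ n → defined cs ⌜ X ↾ n ⌝ xs ≡ 1 → values cs ⌜ X ↾ n ⌝ xs ≡ ys →
             approx c ⌜ X ↾ n ⌝ ys ≡ suc v → approx (comp c cs) ⌜ X ↾ n ⌝ xs ≡ suc v
      both n eq eqs eq′ rewrite eq | eqs = eq′
    approx-complete (ev-prim0 e) = approx-complete e
    approx-complete (ev-primS {b = b} {s = s} {n = m} {xs = xs} {r = r} {v = v} er e) =
      eventually-map (λ n (eq , eq′) → both n eq eq′)
        (eventually-× (approx-complete er) (approx-complete e))
      where
      both : ∀ n → approx (prim b s) ⌜ X ↾ n ⌝ (m ∷ xs) ≡ suc r →
             approx s ⌜ X ↾ n ⌝ (m ∷ r ∷ xs) ≡ suc v →
             approx (prim b s) ⌜ X ↾ n ⌝ (suc m ∷ xs) ≡ suc v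
      both n eq eq′ rewrite eq = eq′
    approx-complete (ev-mu {y = y} e before) = eventually-map
      (λ n ((at , earlier) , y<n) →
        search-complete at earlier ⌜ X ↾ n ⌝ (≤-trans y<n (n≤⌜↾n⌝ X n)))
      (eventually-×
        (eventually-× (approx-complete e)
          (eventually-all< y (λ z z<y → eventually-map (λ _ eq → _ , eq)
            (approx-complete (proj₂ (before z z<y))))))
        -- The search bound must exceed `y`, which `n≤⌜↾n⌝` ensures once `n` does.
        (suc y , λ _ y<n → y<n))

    approx-complete-all : ∀ {k m} {cs : Vec (Code k) m} {xs ys} → EvalAll (χ X) cs xs ys →
                          Eventually (λ n → defined cs ⌜ X ↾ n ⌝ xs ≡ 1 ×
                                            values cs ⌜ X ↾ n ⌝ xs ≡ ys)
    approx-complete-all [] = 0 , λ _ _ → refl , refl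
    approx-complete-all (_∷_ {g = c} {gs = cs} {xs = xs} {y = y} {ys = ys} e es) =
      eventually-map (λ n (eq , eq′ , eqs) → both n eq eq′ eqs)
        (eventually-× (approx-complete e) (approx-complete-all es))
      where
      both : ∀ n → approx c ⌜ X ↾ n ⌝ xs ≡ suc y → defined cs ⌜ X ↾ n ⌝ xs ≡ 1 →
             values cs ⌜ X ↾ n ⌝ xs ≡ ys →
             defined (c ∷ cs) ⌜ X ↾ n ⌝ xs ≡ 1 × values (c ∷ cs) ⌜ X ↾ n ⌝ xs ≡ y ∷ ys
      both n eq eq′ eqs rewrite eq = eq′ , cong (y ∷_) eqs

-- Patching along dyadic blocks

disagree : (ℕ → ℕ) → (ℕ → ℕ) → ℕ → ℕ
disagree f g zero    = 0
disagree f g (suc n) = disagree f g n + (if g n ≡ᵇ f n then 0 else 1)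

agree+disagree : ∀ f g n → agree f g n + disagree f g n ≡ n
agree+disagree f g zero = refl
agree+disagree f g (suc n) with g n ≡ᵇ f n
... | true  = trans (cong₂ _+_ (+-comm (agree f g n) 1) (+-identityʳ _))
                    (cong suc (agree+disagree f g n))
... | false = trans (cong₂ _+_ (+-identityʳ (agree f g n)) (+-comm _ 1))
                    (trans (+-suc _ _) (cong suc (agree+disagree f g n)))

disagree≤ : ∀ f g n → disagree f g n ≤ n
disagree≤ f g n = subst (disagree f g n ≤_) (agree+disagree f g n) (m≤n+m _ _)

disagree-cong : ∀ f {g h} n → (∀ i → i < n → g i ≡ h i) → disagree f g n ≡ disagree f h n
disagree-cong f zero    _  = refl
disagree-cong f (suc n) eq = cong₂ _+_
  (disagree-cong f n (λ i i<n → eq i (m<n⇒m<1+n i<n)))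
  (cong (λ x → if x ≡ᵇ f n then 0 else 1) (eq n ≤-refl))

doubleUnless : ℕ → ℕ → ℕ
doubleUnless zero    b = 2 * b
doubleUnless (suc _) b = b

-- The least power of two above n.
ceil : ℕ → ℕ
ceil zero    = 1
ceil (suc n) = doubleUnless (ceil n ∸ suc n) (ceil n)

data CeilStep (n : ℕ) : ℕ → Set where
  keep   : suc n < ceil n → CeilStep n (ceil n)
  double : suc n ≡ ceil n → CeilStep n (2 * ceil n)

mutual
  <ceil : ∀ n → n < ceil n
  <ceil zero    = s≤s z≤n
  <ceil (suc n) with ceil (suc n) | ceil-step n
  ... | _ | keep lt   = lt
  ... | _ | double eq = subst (λ m → m < 2 * ceil n) (sym eq)
                          (subst (ceil n <_) (cong (ceil n +_) (sym (+-identityʳ _)))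
                            (m<m+n (ceil n) (≤-trans (s≤s z≤n) (<ceil n))))

  ceil-step : ∀ n → CeilStep n (ceil (suc n))
  ceil-step n with ceil n ∸ suc n in eq
  ... | zero  = double (≤-antisym (<ceil n) (m∸n≡0⇒m≤n eq))
  ... | suc k = keep (m∸n≢0⇒n<m (λ eq′ → 0≢1+n (trans (sym eq′) eq)))

ceil≤ : ∀ n → ceil (suc n) ≤ 2 * suc n
ceil≤ zero    = ≤-refl
ceil≤ (suc n) with ceil (suc (suc n)) | ceil-step (suc n)
... | _ | keep _    = ≤-trans (ceil≤ n) (*-monoʳ-≤ 2 (n≤1+n (suc n)))
... | _ | double eq = *-monoʳ-≤ 2 (≤-reflexive (sym eq))

-- If each ψ m has few disagreements with f on every initial segment of
-- [0, m), then so does the function that follows ψ (2^(j+1)) on [2^j, 2^(j+1)):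
-- the errors committed on earlier dyadic blocks form a geometric series.
module DyadicPatching (f : ℕ → ℕ) (ψ : ℕ → ℕ → ℕ) (K N : ℕ)
  (few : ∀ m n → N ≤ n → n ≤ m → K * disagree f (ψ m) n ≤ 2 * n) where

  patched : ℕ → ℕ
  patched n = ψ (ceil n) n

  -- `b` is the right end of the current block and `A` counts the errors before that block; later
  -- ones are charged to `ψ b` on all of [0, n). When a block closes, the bound reproduces itself as
  -- `2 b + 2 b = 2 (2 b)`. The term `K * N` pays for segments shorter than `N`, about which `few`
  -- says nothing.
  Invariant : ℕ → ℕ → Set
  Invariant n b = ∃ λ A → disagree f patched n ≤ A + disagree f (ψ b) n × K * A ≤ 2 * b + K * N

  total : ∀ {n b A} → N ≤ n → n ≤ b → disagree f patched n ≤ A + disagree f (ψ b) n →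
          K * A ≤ 2 * b + K * N → K * disagree f patched n ≤ (2 * b + K * N) + 2 * n
  total {n} {b} {A} N≤n n≤b le KA = begin
    K * disagree f patched n             ≤⟨ *-monoʳ-≤ K le ⟩
    K * (A + disagree f (ψ b) n)         ≡⟨ *-distribˡ-+ K A _ ⟩
    K * A + K * disagree f (ψ b) n       ≤⟨ +-mono-≤ KA (few b n N≤n n≤b) ⟩
    (2 * b + K * N) + 2 * n              ∎
    where open ≤-Reasoning

  invariant : ∀ n → Invariant n (ceil n)
  invariant zero = 0 , z≤n , ≤-trans (≤-reflexive (*-zeroʳ K)) z≤n
  invariant (suc n) with invariant n
  ... | A , le , KA with ceil (suc n) | ceil-step n
  ...   | _ | keep _ = A , le′ , KA
    where
    -- Both sides gain the same error at `n`, because `patched n` unfolds to `ψ (ceil n) n`.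
    le′ : disagree f patched (suc n) ≤ A + disagree f (ψ (ceil n)) (suc n)
    le′ = ≤-trans (+-monoˡ-≤ _ le) (≤-reflexive (+-assoc A _ _))
  -- A new block begins at `suc n`: all errors so far become the new `A`.
  ...   | _ | double eq = disagree f patched (suc n) , m≤m+n _ _ , bound (≤-total N (suc n))
    where
    open ≤-Reasoning
    le′ : disagree f patched (suc n) ≤ A + disagree f (ψ (ceil n)) (suc n)
    le′ = ≤-trans (+-monoˡ-≤ _ le) (≤-reflexive (+-assoc A _ _))
    bound : N ≤ suc n ⊎ suc n ≤ N →
            K * disagree f patched (suc n) ≤ 2 * (2 * ceil n) + K * N
    bound (inj₂ n<N) = begin
      K * disagree f patched (suc n)       ≤⟨ *-monoʳ-≤ K (≤-trans (disagree≤ f patched (suc n)) n<N) ⟩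
      K * N                                ≤⟨ m≤n+m _ _ ⟩
      2 * (2 * ceil n) + K * N             ∎
    bound (inj₁ N≤n) = begin
      K * disagree f patched (suc n)       ≤⟨ total N≤n (≤-reflexive eq) le′ KA ⟩
      (2 * ceil n + K * N) + 2 * suc n     ≡⟨ cong (λ m → (2 * ceil n + K * N) + 2 * m) eq ⟩
      (2 * ceil n + K * N) + 2 * ceil n    ≡⟨ solve 2 (λ b k → (con 2 :* b :+ k) :+ con 2 :* b :=
                                                con 2 :* (con 2 :* b) :+ k) refl (ceil n) (K * N) ⟩
      2 * (2 * ceil n) + K * N             ∎

  -- Of the `6`, four come from earlier blocks, since `ceil (suc n)` is at most `2 * suc n`, and two
  -- from the current `ψ`.
  disagree-patched : ∀ n → N ≤ suc n → K * disagree f patched (suc n) ≤ 6 * suc n + K * N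
  disagree-patched n N≤n = let A , le , KA = invariant (suc n) in begin
    K * disagree f patched (suc n)           ≤⟨ total N≤n (<⇒≤ (<ceil (suc n))) le KA ⟩
    (2 * ceil (suc n) + K * N) + 2 * suc n   ≤⟨ +-monoˡ-≤ _ (+-monoˡ-≤ _ (*-monoʳ-≤ 2 (ceil≤ n))) ⟩
    (2 * (2 * suc n) + K * N) + 2 * suc n    ≡⟨ solve 2 (λ m k → (con 2 :* (con 2 :* m) :+ k) :+ con 2 :* m :=
                                                con 6 :* m :+ k) refl (suc n) (K * N) ⟩
    6 * suc n + K * N                        ∎
    where open ≤-Reasoning

-- The f-c.e. set to which genericity is applied

isZero : ℕ → ℕ
isZero zero    = 1
isZero (suc _) = 0

differ : ℕ → ℕ → ℕ
differ x y = 1 ∸ isZero ((x ∸ y) + (y ∸ x))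

differ-≡ᵇ : ∀ x y → differ x y ≡ (if x ≡ᵇ y then 0 else 1)
differ-≡ᵇ zero    zero    = refl
differ-≡ᵇ zero    (suc y) = refl
differ-≡ᵇ (suc x) zero    = refl
differ-≡ᵇ (suc x) (suc y) = differ-≡ᵇ x y

output : Code 1 → ℕ → ℕ → ℕ
output c a n = pred (approx c a (n ∷ []))

undefinedBelow : Code 1 → ℕ → ℕ → ℕ
undefinedBelow c a zero    = 0
undefinedBelow c a (suc n) = undefinedBelow c a n + isZero (approx c a (n ∷ []))

undefinedBelow≡0⇒ : ∀ c a n → undefinedBelow c a n ≡ 0 →
                    ∀ i → i < n → ∃ λ v → approx c a (i ∷ []) ≡ suc v
undefinedBelow≡0⇒ c a (suc n) eq i i<1+n with m<1+n⇒m<n∨m≡n i<1+n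
... | inj₁ i<n = undefinedBelow≡0⇒ c a n (m+n≡0⇒m≡0 _ eq) i i<n
... | inj₂ refl with approx c a (i ∷ []) | m+n≡0⇒n≡0 (undefinedBelow c a n) eq
...   | suc v | _ = v , refl

undefinedBelow≡0⇐ : ∀ c a n → (∀ i → i < n → ∃ λ v → approx c a (i ∷ []) ≡ suc v) →
                    undefinedBelow c a n ≡ 0
undefinedBelow≡0⇐ c a zero    def = refl
undefinedBelow≡0⇐ c a (suc n) def
  rewrite proj₂ (def n ≤-refl) | undefinedBelow≡0⇐ c a n (λ i i<n → def i (m<n⇒m<1+n i<n)) = refl

undefinedBelow-≤ : ∀ c a {n m} → n ≤ m → undefinedBelow c a m ≡ 0 → undefinedBelow c a n ≡ 0
undefinedBelow-≤ c a n≤m eq = undefinedBelow≡0⇐ c a _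
  (λ i i<n → undefinedBelow≡0⇒ c a _ eq i (≤-trans i<n n≤m))

-- Vanishes iff N ≤ n, the code c is defined on [0, n) with oracle string a,
-- and 2 n < K d for the number d of its disagreements with f there.
defect : (ℕ → ℕ) → Code 1 → ℕ → ℕ → ℕ → ℕ → ℕ
defect f c K N n a =
  (N ∸ n) + (undefinedBelow c a n + (suc (2 * n) ∸ K * disagree f (output c a) n))

module _ {O : Oracle} where

  rec-doubleUnless : Rec₂ {O} doubleUnless
  rec-doubleUnless = curry₂ (rec-prim (λ { (_ ∷ []) → refl }) (λ { _ (_ ∷ []) → refl })
                              (rec-scale 2 (rec-var v₀)) (rec-var v₂))

  rec-ceil : Rec₁ {O} ceil
  rec-ceil = curry₁ (rec-prim (λ { [] → refl }) (λ { _ [] → refl }) (rec-const 1)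
    (ap₂ rec-doubleUnless (ap₂ rec-∸ (rec-var v₁) (ap₁ rec-suc (rec-var v₀))) (rec-var v₁)))

  rec-isZero : Rec₁ {O} isZero
  rec-isZero = curry₁ (rec-prim (λ { [] → refl }) (λ { _ [] → refl }) (rec-const 1) (rec-const 0))

  rec-differ : Rec₂ {O} differ
  rec-differ = curry₂ (ap₁ rec-1∸ (ap₁ rec-isZero (ap₂ rec-+
    (ap₂ rec-∸ (rec-var v₀) (rec-var v₁)) (ap₂ rec-∸ (rec-var v₁) (rec-var v₀)))))

  rec-approx₁ : (c : Code 1) → Rec₂ {O} (λ a n → approx c a (n ∷ []))
  rec-approx₁ c = proj₁ (rec-approx c) , λ a n → proj₂ (rec-approx c) (a ∷ n ∷ [])

  rec-output : (c : Code 1) → Rec₂ {O} (output c)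
  rec-output c = curry₂ (ap₁ rec-pred (ap₂ (rec-approx₁ c) (rec-var v₀) (rec-var v₁)))

  rec-undefinedBelow : (c : Code 1) → Rec₂ {O} (λ n a → undefinedBelow c a n)
  rec-undefinedBelow c = curry₂ (rec-prim (λ { (_ ∷ []) → refl }) (λ { _ (_ ∷ []) → refl })
    (rec-const 0)
    (ap₂ rec-+ (rec-var v₁) (ap₁ rec-isZero (ap₂ (rec-approx₁ c) (rec-var v₂) (rec-var v₀)))))

module _ (f : ℕ → ℕ) (c : Code 1) where

  rec-oracle : Rec₁ {f} f
  rec-oracle = orac , λ _ → ev-orac

  -- Only here is the oracle `f` consulted. `rec-undefinedBelow` holds over every oracle, so the
  -- later search for extensions is computable outright.
  rec-disagree : Rec₂ {f} (λ n a → disagree f (output c a) n)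
  rec-disagree = curry₂ (rec-prim (λ { (_ ∷ []) → refl })
    (λ { n (a ∷ []) → cong (disagree f (output c a) n +_) (differ-≡ᵇ (output c a n) (f n)) })
    (rec-const 0)
    (ap₂ rec-+ (rec-var v₁) (ap₂ rec-differ (ap₂ (rec-output c) (rec-var v₂) (rec-var v₀))
                                             (ap₁ rec-oracle (rec-var v₀)))))

  rec-defect : ∀ K N → Rec₂ {f} (defect f c K N)
  rec-defect K N = curry₂ (ap₂ rec-+ (ap₂ rec-∸ (rec-const N) (rec-var v₀))
    (ap₂ rec-+ (ap₂ (rec-undefinedBelow c) (rec-var v₀) (rec-var v₁))
      (ap₂ rec-∸ (ap₁ rec-suc (rec-scale 2 (rec-var v₀)))
        (rec-scale K (ap₂ rec-disagree (rec-var v₀) (rec-var v₁))))))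

  -- As `defect` is total, this minimisation over `n` halts on a string exactly when some `n` has
  -- defect zero.
  defectSet : ℕ → ℕ → Code 1
  defectSet K N = mu (proj₁ (rec-defect K N))

  ∈defectSet⇒ : ∀ K N σ → InW f (defectSet K N) σ → ∃ λ n → defect f c K N n ⌜ σ ⌝ ≡ 0
  ∈defectSet⇒ K N σ (n , ev-mu e _) =
    n , Eval-functional (proj₂ (rec-defect K N) n ⌜ σ ⌝) e

  ∈defectSet⇐ : ∀ K N σ n → defect f c K N n ⌜ σ ⌝ ≡ 0 → InW f (defectSet K N) σ
  ∈defectSet⇐ K N σ n eq =
    let y , y≡0 , before = least-zero (λ n → defect f c K N n ⌜ σ ⌝) (n , eq)
        d , ev = rec-defect K N in
    y , ev-mu (subst (Eval f d _) y≡0 (ev y ⌜ σ ⌝))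
              (λ z z<y → let w , z≡w = before z z<y in
                         w , subst (Eval f d _) z≡w (ev z ⌜ σ ⌝))

-- From an `X`-computable function to a computable one

few-disagreements : ∀ f X g K N → OneGeneric f X → Computable (χ X) g →
  (∀ n → N ≤ n → K * disagree f g n ≤ 2 * n) →
  ∃ λ g′ → Computable ∅O g′ × (∀ n → N ≤ suc n → K * disagree f g′ (suc n) ≤ 6 * suc n + K * N)
few-disagreements f X g K N generic (c , computes) few-g with generic (defectSet f c K N)
-- By `approx-sound`, outputs obtained from an initial segment of `X` are values of `g`, so `g`
-- itself would have too many disagreements.
... | inj₁ (l , meets) =
  contradiction (few-g n (m∸n≡0⇒m≤n (m+n≡0⇒m≡0 _ n-defect))) (<⇒≱ many)
  where
  a = ⌜ X ↾ l ⌝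
  n = proj₁ (∈defectSet⇒ f c K N (X ↾ l) meets)
  n-defect : defect f c K N n a ≡ 0
  n-defect = proj₂ (∈defectSet⇒ f c K N (X ↾ l) meets)
  rest : undefinedBelow c a n + (suc (2 * n) ∸ K * disagree f (output c a) n) ≡ 0
  rest = m+n≡0⇒n≡0 (N ∸ n) n-defect
  correct : ∀ i → i < n → output c a i ≡ g i
  correct i i<n with undefinedBelow≡0⇒ c a n (m+n≡0⇒m≡0 _ rest) i i<n | approx-sound X (computes i) l
  ... | _ , def | inj₁ undef with () ← trans (sym def) undef
  ... | _       | inj₂ eq = cong pred eq
  many : 2 * n < K * disagree f g n
  many = subst (λ d → 2 * n < K * d) (disagree-cong f n correct)
           (m∸n≡0⇒m≤n (m+n≡0⇒n≡0 (undefinedBelow c a n) rest))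
... | inj₂ (l , avoids) = patched , computable , disagree-patched
  where
  σ = X ↾ l

  -- The witness comes from `X`: length `M + l` suffices for convergence below `m` and makes the
  -- segment extend `σ`.
  total : (v : Vec ℕ 1) → ∃ λ t → undefinedBelow c (prepend σ t) (lookup v v₀) ≡ 0
  total (m ∷ []) with eventually-all< m (λ i _ → approx-complete X (computes i))
  ... | M , converges with ↾-+ X l M
  ...   | τ , eq = ⌜ τ ⌝ , trans
    (cong (λ a → undefinedBelow c a m) (trans (prepend-⌜⌝ σ τ) (cong ⌜_⌝ (sym eq))))
    (undefinedBelow≡0⇐ c _ m (λ i i<m → g i , converges (M + l) (m≤m+n M l) i i<m))

  -- All that is left of `X` is the finite string `σ`, built into the code; hence the empty oracle.
  rec-convergence : Rec ∅O {2} (λ v → undefinedBelow c (prepend σ (lookup v v₀)) (lookup v v₁))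
  rec-convergence = ap₂ (rec-undefinedBelow c) (rec-var v₁) (ap₁ (rec-prepend σ) (rec-var v₀))

  extension : ℕ → ℕ
  extension m = proj₁ (least-zero (λ t → undefinedBelow c (prepend σ t) m) (total (m ∷ [])))

  extension-converges : ∀ m → undefinedBelow c (prepend σ (extension m)) m ≡ 0
  extension-converges m =
    proj₁ (proj₂ (least-zero (λ t → undefinedBelow c (prepend σ t) m) (total (m ∷ []))))

  rec-extension : Rec₁ extension
  rec-extension = let d , ev = rec-mu rec-convergence total in d , λ m → ev (m ∷ [])

  ψ : ℕ → ℕ → ℕ
  ψ m = output c (prepend σ (extension m))

  -- Otherwise `n` would put `σ ++ τ` into the set, where `τ` is decoded from the extension found;
  -- convergence below `m` gives convergence below `n`.
  few : ∀ m n → N ≤ n → n ≤ m → K * disagree f (ψ m) n ≤ 2 * n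
  few m n N≤n n≤m = ≮⇒≥ λ lt → avoids τ (∈defectSet⇐ f c K N (σ ++ τ) n (defect≡0 lt))
    where
    t = extension m
    τ = proj₁ (⌜⌝-surjective t)
    coded : ⌜ σ ++ τ ⌝ ≡ prepend σ t
    coded = trans (sym (prepend-⌜⌝ σ τ)) (cong (prepend σ) (proj₂ (⌜⌝-surjective t)))
    defect≡0 : 2 * n < K * disagree f (ψ m) n → defect f c K N n ⌜ σ ++ τ ⌝ ≡ 0
    defect≡0 lt rewrite coded | m≤n⇒m∸n≡0 N≤n
      | undefinedBelow-≤ c (prepend σ t) n≤m (extension-converges m) = m≤n⇒m∸n≡0 lt

  open DyadicPatching f ψ K N few using (patched; disagree-patched)

  computable : Computable ∅O patched
  computable = curry₁ (ap₂ (rec-output c)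
    (ap₁ (rec-prepend σ) (ap₁ rec-extension (ap₁ rec-ceil (rec-var v₀)))) (rec-var v₀))

-- Densities as inequalities between natural numbers

few⇒≤ρ : ∀ f g m q → q ℚ.< ℚ.1ℚ →
         suc (ℚ.ℚ.denominator-1 q) * disagree f g (suc m) ≤ suc m → q ℚ.≤ ρ f g m
few⇒≤ρ f g m q@(ℚ.mkℚ p d _) q<1 few = ℚ.toℚᵘ-cancel-≤
  (ℚᵘ.≤-respʳ-≃ (ℚᵘ.≃-sym (ℚ.toℚᵘ-fromℚᵘ (ℚᵘ.mkℚᵘ (ℤ.+ a) m))) (ℚᵘ.*≤* p*n≤a*d))
  where
  a = agree f g (suc m)
  e = disagree f g (suc m)
  -- `mkℚ` stores the denominator minus one, so `q < 1` means `q ≤ 1 - 1/(d+1)`, while `few` bounds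
  -- the fraction of disagreements by `1/(d+1)`.
  p≤d : p ℤ.≤ ℤ.+ d
  p≤d = ℤ.i<j⇒i≤pred[j] (subst₂ ℤ._<_ (ℤ.*-identityʳ p) (ℤ.*-identityˡ (ℤ.+ suc d)) (ℚ.drop-*<* q<1))
  d*n≤a*d : d * suc m ≤ a * suc d
  d*n≤a*d = +-cancelˡ-≤ (suc m) _ _ (begin
    suc d * suc m          ≡⟨ cong (suc d *_) (agree+disagree f g (suc m)) ⟨
    suc d * (a + e)        ≡⟨ *-distribˡ-+ (suc d) a e ⟩
    suc d * a + suc d * e  ≤⟨ +-monoʳ-≤ (suc d * a) few ⟩
    suc d * a + suc m      ≡⟨ +-comm (suc d * a) (suc m) ⟩
    suc m + suc d * a      ≡⟨ cong (suc m +_) (*-comm (suc d) a) ⟩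
    suc m + a * suc d      ∎)
    where open ≤-Reasoning
  p*n≤a*d : p ℤ.* ℤ.+ suc m ℤ.≤ ℤ.+ a ℤ.* ℤ.+ suc d
  p*n≤a*d = ℤ.≤-trans (ℤ.*-monoʳ-≤-nonNeg (ℤ.+ suc m) p≤d)
    (subst₂ ℤ._≤_ (ℤ.pos-* d (suc m)) (ℤ.pos-* a (suc d)) (ℤ.+≤+ d*n≤a*d))

-- The hypothesis says that the density is at least `1 - 2/(k+1)`; this is the origin of the `2` in
-- the bounds `2 * n` above.
≤ρ⇒few : ∀ f g m k → (ℤ.+ k ℚ./ suc k) ℚ.- (ℤ.+ 1 ℚ./ suc k) ℚ.≤ ρ f g m →
         suc k * disagree f g (suc m) ≤ 2 * suc m
≤ρ⇒few f g m k q-ε≤ρ = +-cancelˡ-≤ (suc k * a) _ _ (begin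
  suc k * a + suc k * e        ≡⟨ *-distribˡ-+ (suc k) a e ⟨
  suc k * (a + e)              ≡⟨ cong (suc k *_) (agree+disagree f g (suc m)) ⟩
  suc m + k * suc m            ≤⟨ +-monoʳ-≤ (suc m) k*n≤ ⟩
  suc m + (a * suc k + suc m)  ≡⟨ solve 3 (λ m a k → m :+ (a :* k :+ m) := k :* a :+ con 2 :* m)
                                    refl (suc m) a (suc k) ⟩
  suc k * a + 2 * suc m        ∎)
  where
  open ≤-Reasoning
  a = agree f g (suc m)
  e = disagree f g (suc m)
  q = ℤ.+ k ℚ./ suc k
  ε = ℤ.+ 1 ℚ./ suc k
  q≤ρ+ε : q ℚ.≤ ρ f g m ℚ.+ ε
  q≤ρ+ε = subst (ℚ._≤ ρ f g m ℚ.+ ε)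
    (trans (ℚ.+-assoc q (ℚ.- ε) ε) (trans (cong (q ℚ.+_) (ℚ.+-inverseˡ ε)) (ℚ.+-identityʳ q)))
    (ℚ.+-monoˡ-≤ ε q-ε≤ρ)
  unnormalised : ℚᵘ.mkℚᵘ (ℤ.+ k) k ℚᵘ.≤ ℚᵘ.mkℚᵘ (ℤ.+ a) m ℚᵘ.+ ℚᵘ.mkℚᵘ (ℤ.+ 1) k
  unnormalised = ℚᵘ.≤-respˡ-≃ (ℚ.toℚᵘ-fromℚᵘ (ℚᵘ.mkℚᵘ (ℤ.+ k) k))
    (ℚᵘ.≤-respʳ-≃
      (ℚᵘ.≃-trans (ℚ.toℚᵘ-homo-+ (ρ f g m) ε)
        (ℚᵘ.+-cong (ℚ.toℚᵘ-fromℚᵘ (ℚᵘ.mkℚᵘ (ℤ.+ a) m)) (ℚ.toℚᵘ-fromℚᵘ (ℚᵘ.mkℚᵘ (ℤ.+ 1) k))))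
      (ℚ.toℚᵘ-mono-≤ q≤ρ+ε))
  -- The sum has denominator `suc m * suc k`, so cross-multiplying leaves a factor `suc k` to
  -- cancel.
  k*n≤ : k * suc m ≤ a * suc k + suc m
  k*n≤ = *-cancelʳ-≤ _ _ (suc k) (subst (_≤ (a * suc k + suc m) * suc k)
    (sym (*-assoc k (suc m) (suc k)))
    (ℤ.drop‿+≤+ (subst₂ ℤ._≤_ (sym (ℤ.pos-* k (suc m * suc k))) right
      (ℚᵘ.drop-*≤* unnormalised))))
    where
    right : (ℤ.+ a ℤ.* ℤ.+ suc k ℤ.+ ℤ.+ 1 ℤ.* ℤ.+ suc m) ℤ.* ℤ.+ suc k ≡
            ℤ.+ ((a * suc k + suc m) * suc k)
    right = trans
      (cong₂ (λ x y → (x ℤ.+ y) ℤ.* ℤ.+ suc k) (sym (ℤ.pos-* a (suc k)))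
        (ℤ.*-identityˡ (ℤ.+ suc m)))
      (sym (ℤ.pos-* (a * suc k + suc m) (suc k)))

theorem6p10 : (f : ℕ → ℕ) (X : ℕ → Bool) →
    γ<1 ∅O f → OneGeneric f X → γ<1 (χ X) f
theorem6p10 f X (q , q<1 , unreachable) generic = ℤ.+ k ℚ./ suc k , k/K<1 , contradict
  where
  d = suc (ℚ.ℚ.denominator-1 q)
  -- This makes `suc k` equal to `8 * d`. Patching costs `6 * n + 8 * d * N`; once `4 * (d * N) ≤ n`
  -- the total is at most `8 * n`, and dividing by 8 gives the bound that `few⇒≤ρ` asks for.
  k = pred (8 * d)

  k/K<1 : ℤ.+ k ℚ./ suc k ℚ.< ℚ.1ℚ
  k/K<1 = ℚ.toℚᵘ-cancel-< (ℚᵘ.<-respˡ-≃ (ℚᵘ.≃-sym (ℚ.toℚᵘ-fromℚᵘ (ℚᵘ.mkℚᵘ (ℤ.+ k) k)))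
    (ℚᵘ.*<* (subst₂ ℤ._<_ (sym (ℤ.*-identityʳ _)) (sym (ℤ.*-identityˡ _)) (ℤ.+<+ ≤-refl))))

  ε>0 : ℚ.0ℚ ℚ.< ℤ.+ 1 ℚ./ suc k
  ε>0 = ℚ.positive⁻¹ _ {{ℚ.normalize-pos 1 (suc k)}}

  contradict : ∀ g → Computable (χ X) g → ¬ LowerDensity≥ f g (ℤ.+ k ℚ./ suc k)
  contradict g computable density = unreachable g′ g′-computable g′-density
    where
    -- `ρ f g m` concerns the segment of length `suc m`, so the threshold on lengths is one more.
    N = suc (proj₁ (density _ ε>0))
    few : ∀ n → N ≤ n → suc k * disagree f g n ≤ 2 * n
    few (suc m) (s≤s N≤m) = ≤ρ⇒few f g m k (proj₂ (density _ ε>0) m N≤m)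
    result = few-disagreements f X g (suc k) N generic computable few
    g′ = proj₁ result
    g′-computable = proj₁ (proj₂ result)
    bound : ∀ m → N ≤ m → 4 * (d * N) ≤ m → d * disagree f g′ (suc m) ≤ suc m
    bound m N≤m le = *-cancelˡ-≤ 8 (begin
      8 * (d * disagree f g′ (suc m))    ≡⟨ *-assoc 8 d _ ⟨
      suc k * disagree f g′ (suc m)      ≤⟨ proj₂ (proj₂ result) m (m≤n⇒m≤1+n N≤m) ⟩
      6 * suc m + 8 * d * N              ≡⟨ cong (6 * suc m +_)
                                              (trans (*-assoc 8 d N) (*-assoc 2 4 (d * N))) ⟩
      6 * suc m + 2 * (4 * (d * N))      ≤⟨ +-monoʳ-≤ (6 * suc m) (*-monoʳ-≤ 2 (m≤n⇒m≤1+n le)) ⟩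
      6 * suc m + 2 * suc m              ≡⟨ *-distribʳ-+ (suc m) 6 2 ⟨
      8 * suc m                          ∎)
      where open ≤-Reasoning
    g′-density : LowerDensity≥ f g′ q
    -- The threshold is independent of `ε`, since `ρ` eventually reaches `q` itself.
    g′-density ε ε>0 = N + 4 * (d * N) , λ m le → ℚ.≤-trans q-ε≤q
      (few⇒≤ρ f g′ m q q<1 (bound m (≤-trans (m≤m+n N _) le) (≤-trans (m≤n+m _ N) le)))
      where
      q-ε≤q : q ℚ.- ε ℚ.≤ q
      q-ε≤q = subst (q ℚ.- ε ℚ.≤_) (ℚ.+-identityʳ q)
        (ℚ.+-monoʳ-≤ q (ℚ.neg-antimono-≤ (ℚ.<⇒≤ ε>0)))
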